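{- Let $x$ and $s$ be positive integers. The infinite continued fraction $$F(x,s):=\left[x,\frac{s}{x},x^2,\frac{s}{x^2},x^3,\frac{s}{x^3},x^4,\frac{s}{x^4},\dots,x^k,\frac{s}{x^k},\dots\right]$$ converges to the positive root (in $z$) of the quadratic $P(x,z,s)=sz^2-((s+1)x-1)z-x$.
   Context: For positive real numbers $b_0,b_1,b_2,\dots$, $[b_0,b_1,\dots,b_n]$ denotes the finite continued fraction $b_0+\cfrac{1}{b_1+\cfrac{1}{b_2+\cdots+\cfrac{1}{b_n}}}$ (the partial quotients need not be integers). The infinite continued fraction $[b_0,b_1,b_2,\dots]$ converges to $L$ if its sequence of convergents $[b_0,b_1,\dots,b_n]$ tends to $L$ as $n\to\infty$. In $F(x,s)$ the partial quotients are $b_{2i-2}=x^i$ and $b_{2i-1}=s/x^i$ for $i\ge1$. -}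

module Defs where

open import Data.Nat as ℕ using (ℕ; zero; suc)
import Data.Nat.Properties as ℕ
open import Data.Integer using (+_)
open import Data.Rational as ℚ using (ℚ; 0ℚ; 1ℚ; ½; Positive)
import Data.Rational.Properties as ℚ
open import Data.Rational.Solver using (module +-*-Solver)
open import Data.Product using (Σ; ∃-syntax; _×_; _,_; proj₁)
open import Data.Sum using (inj₁; inj₂)
open import Function using (_∘_)
open import Relation.Binary.PropositionalEquality
  using (_≡_; refl; sym; trans; cong; subst; subst₂)

-- The standard library has no real numbers. They are represented here by
-- Cauchy sequences of rationals, compared by the equivalence _≃_ below.

IsCauchy : (ℕ → ℚ) → Set
IsCauchy u = ∀ ε → 0ℚ ℚ.< ε →
  ∃[ N ] (∀ m n → N ℕ.≤ m → N ℕ.≤ n → ℚ.∣ u m ℚ.- u n ∣ ℚ.< ε)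

private abstract

  half-pos : ∀ {ε} → 0ℚ ℚ.< ε → 0ℚ ℚ.< ½ ℚ.* ε
  half-pos {ε} ε>0 =
    subst (ℚ._< ½ ℚ.* ε) (ℚ.*-zeroʳ ½) (ℚ.*-monoʳ-<-pos ½ ε>0)

  half+half : ∀ ε → ½ ℚ.* ε ℚ.+ ½ ℚ.* ε ≡ ε
  half+half ε = trans (sym (ℚ.*-distribʳ-+ ε ½ ½)) (ℚ.*-identityˡ ε)

  +-interchange : ∀ a b c d →
    (a ℚ.- c) ℚ.+ (b ℚ.- d) ≡ (a ℚ.+ b) ℚ.- (c ℚ.+ d)
  +-interchange = solve 4 (λ a b c d →
    (a :+ :- c) :+ (b :+ :- d) := (a :+ b) :+ :- (c :+ d)) refl
    where open +-*-Solver

  *-difference : ∀ a b c d →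
    a ℚ.* (b ℚ.- d) ℚ.+ d ℚ.* (a ℚ.- c) ≡ a ℚ.* b ℚ.- c ℚ.* d
  *-difference = solve 4 (λ a b c d →
    a :* (b :+ :- d) :+ d :* (a :+ :- c) := a :* b :+ :- (c :* d)) refl
    where open +-*-Solver

  neg-difference : ∀ a b → ℚ.- (a ℚ.- b) ≡ ℚ.- a ℚ.- ℚ.- b
  neg-difference = solve 2 (λ a b →
    :- (a :+ :- b) := :- a :+ :- (:- b)) refl
    where open +-*-Solver

  split : ∀ a b → b ℚ.+ (a ℚ.- b) ≡ a
  split = solve 2 (λ a b → b :+ (a :+ :- b) := a) refl
    where open +-*-Solver

  ∣a∣≤∣b∣+∣a-b∣ : ∀ a b → ℚ.∣ a ∣ ℚ.≤ ℚ.∣ b ∣ ℚ.+ ℚ.∣ a ℚ.- b ∣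
  ∣a∣≤∣b∣+∣a-b∣ a b = subst (λ t → ℚ.∣ t ∣ ℚ.≤ ℚ.∣ b ∣ ℚ.+ ℚ.∣ a ℚ.- b ∣)
    (split a b) (ℚ.∣p+q∣≤∣p∣+∣q∣ b (a ℚ.- b))

  a+b-a≡b : ∀ a b → (a ℚ.+ b) ℚ.- a ≡ b
  a+b-a≡b = solve 2 (λ a b → (a :+ b) :+ :- a := b) refl
    where open +-*-Solver

  -[a-b]≡b-a : ∀ a b → ℚ.- (a ℚ.- b) ≡ b ℚ.- a
  -[a-b]≡b-a = solve 2 (λ a b → :- (a :+ :- b) := b :+ :- a) refl
    where open +-*-Solver

  ∣a-b∣≡∣b-a∣ : ∀ a b → ℚ.∣ a ℚ.- b ∣ ≡ ℚ.∣ b ℚ.- a ∣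
  ∣a-b∣≡∣b-a∣ a b =
    trans (sym (ℚ.∣-p∣≡∣p∣ (a ℚ.- b))) (cong ℚ.∣_∣ (-[a-b]≡b-a a b))

  ∣a∣-∣b∣≤∣a-b∣ : ∀ a b → ℚ.∣ a ∣ ℚ.- ℚ.∣ b ∣ ℚ.≤ ℚ.∣ a ℚ.- b ∣
  ∣a∣-∣b∣≤∣a-b∣ a b = subst (ℚ.∣ a ∣ ℚ.- ℚ.∣ b ∣ ℚ.≤_)
    (a+b-a≡b ℚ.∣ b ∣ ℚ.∣ a ℚ.- b ∣)
    (ℚ.+-monoˡ-≤ (ℚ.- ℚ.∣ b ∣) (∣a∣≤∣b∣+∣a-b∣ a b))

  ∣∣a∣-∣b∣∣≤∣a-b∣ : ∀ a b →
    ℚ.∣ ℚ.∣ a ∣ ℚ.- ℚ.∣ b ∣ ∣ ℚ.≤ ℚ.∣ a ℚ.- b ∣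
  ∣∣a∣-∣b∣∣≤∣a-b∣ a b with ℚ.∣p∣≡p∨∣p∣≡-p (ℚ.∣ a ∣ ℚ.- ℚ.∣ b ∣)
  ... | inj₁ ∣d∣≡d  = subst (ℚ._≤ ℚ.∣ a ℚ.- b ∣) (sym ∣d∣≡d) (∣a∣-∣b∣≤∣a-b∣ a b)
  ... | inj₂ ∣d∣≡-d = subst₂ ℚ._≤_
    (sym (trans ∣d∣≡-d (-[a-b]≡b-a ℚ.∣ a ∣ ℚ.∣ b ∣)))
    (∣a-b∣≡∣b-a∣ b a)
    (∣a∣-∣b∣≤∣a-b∣ b a)

  const-cauchy : ∀ q → IsCauchy (λ _ → q)
  const-cauchy q ε ε>0 = 0 , λ _ _ _ _ →
    subst (ℚ._< ε) (sym (cong ℚ.∣_∣ (ℚ.+-inverseʳ q))) ε>0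

  +-cauchy : ∀ {u v} → IsCauchy u → IsCauchy v → IsCauchy (λ n → u n ℚ.+ v n)
  +-cauchy {u} {v} cu cv ε ε>0
    with cu (½ ℚ.* ε) (half-pos ε>0) | cv (½ ℚ.* ε) (half-pos ε>0)
  ... | M , hu | N , hv = M ℕ.⊔ N , λ m n M⊔N≤m M⊔N≤n → begin-strict
    ℚ.∣ (u m ℚ.+ v m) ℚ.- (u n ℚ.+ v n) ∣
      ≡⟨ cong ℚ.∣_∣ (+-interchange (u m) (v m) (u n) (v n)) ⟨
    ℚ.∣ (u m ℚ.- u n) ℚ.+ (v m ℚ.- v n) ∣
      ≤⟨ ℚ.∣p+q∣≤∣p∣+∣q∣ (u m ℚ.- u n) (v m ℚ.- v n) ⟩
    ℚ.∣ u m ℚ.- u n ∣ ℚ.+ ℚ.∣ v m ℚ.- v n ∣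
      <⟨ ℚ.+-mono-< (hu m n (ℕ.m⊔n≤o⇒m≤o M N M⊔N≤m) (ℕ.m⊔n≤o⇒m≤o M N M⊔N≤n))
                    (hv m n (ℕ.m⊔n≤o⇒n≤o M N M⊔N≤m) (ℕ.m⊔n≤o⇒n≤o M N M⊔N≤n)) ⟩
    ½ ℚ.* ε ℚ.+ ½ ℚ.* ε
      ≡⟨ half+half ε ⟩
    ε ∎
    where open ℚ.≤-Reasoning

  neg-cauchy : ∀ {u} → IsCauchy u → IsCauchy (λ n → ℚ.- u n)
  neg-cauchy {u} cu ε ε>0 with cu ε ε>0
  ... | N , h = N , λ m n N≤m N≤n → subst (ℚ._< ε)
    (trans (sym (ℚ.∣-p∣≡∣p∣ (u m ℚ.- u n)))
           (cong ℚ.∣_∣ (neg-difference (u m) (u n))))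
    (h m n N≤m N≤n)

  abs-cauchy : ∀ {u} → IsCauchy u → IsCauchy (λ n → ℚ.∣ u n ∣)
  abs-cauchy {u} cu ε ε>0 with cu ε ε>0
  ... | N , h = N , λ m n N≤m N≤n →
    ℚ.≤-<-trans (∣∣a∣-∣b∣∣≤∣a-b∣ (u m) (u n)) (h m n N≤m N≤n)

  eventual-bound : ∀ {u} → IsCauchy u →
    ∃[ B ] Positive B × ∃[ N ] (∀ n → N ℕ.≤ n → ℚ.∣ u n ∣ ℚ.≤ B)
  eventual-bound {u} cu with cu 1ℚ (ℚ.positive⁻¹ 1ℚ)
  ... | N , h = ℚ.∣ u N ∣ ℚ.+ 1ℚ
    , ℚ.nonNeg+pos⇒pos ℚ.∣ u N ∣ {{ℚ.∣-∣-nonNeg (u N)}} 1ℚ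
    , N , λ n N≤n → ℚ.≤-trans (∣a∣≤∣b∣+∣a-b∣ (u n) (u N))
        (ℚ.+-monoʳ-≤ ℚ.∣ u N ∣ (ℚ.<⇒≤ (h n N N≤n ℕ.≤-refl)))

  -- A factor bounded by B, times one that is eventually below every ε.
  scaled : ∀ B → Positive B → ∀ {ε} → 0ℚ ℚ.< ε →
    ∃[ δ ] 0ℚ ℚ.< δ × (∀ a d → ℚ.∣ a ∣ ℚ.≤ B → ℚ.∣ d ∣ ℚ.< δ → ℚ.∣ a ℚ.* d ∣ ℚ.< ε)
  scaled B B>0 {ε} ε>0 = δ , δ>0 , λ a d a≤B d<δ → begin-strict
    ℚ.∣ a ℚ.* d ∣         ≡⟨ ℚ.∣p*q∣≡∣p∣*∣q∣ a d ⟩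
    ℚ.∣ a ∣ ℚ.* ℚ.∣ d ∣   ≤⟨ ℚ.*-monoʳ-≤-nonNeg ℚ.∣ d ∣ {{ℚ.∣-∣-nonNeg d}} a≤B ⟩
    B ℚ.* ℚ.∣ d ∣         <⟨ ℚ.*-monoʳ-<-pos B d<δ ⟩
    B ℚ.* δ               ≡⟨ ℚ.*-assoc B (ℚ.1/ B) ε ⟨
    B ℚ.* ℚ.1/ B ℚ.* ε    ≡⟨ cong (ℚ._* ε) (ℚ.*-inverseʳ B) ⟩
    1ℚ ℚ.* ε              ≡⟨ ℚ.*-identityˡ ε ⟩
    ε ∎
    where
    open ℚ.≤-Reasoning
    instance
      B-pos : Positive B
      B-pos = B>0
      B-nonZero : ℚ.NonZero B
      B-nonZero = ℚ.pos⇒nonZero B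
    δ : ℚ
    δ = ℚ.1/ B ℚ.* ε
    δ>0 : 0ℚ ℚ.< δ
    δ>0 = subst (ℚ._< δ) (ℚ.*-zeroʳ (ℚ.1/ B))
      (ℚ.*-monoʳ-<-pos (ℚ.1/ B) {{ℚ.1/pos⇒pos B}} ε>0)

  split-product : ∀ a b c d ε →
    ℚ.∣ a ℚ.* (b ℚ.- d) ∣ ℚ.< ½ ℚ.* ε → ℚ.∣ d ℚ.* (a ℚ.- c) ∣ ℚ.< ½ ℚ.* ε →
    ℚ.∣ a ℚ.* b ℚ.- c ℚ.* d ∣ ℚ.< ε
  split-product a b c d ε h₁ h₂ = begin-strict
    ℚ.∣ a ℚ.* b ℚ.- c ℚ.* d ∣
      ≡⟨ cong ℚ.∣_∣ (*-difference a b c d) ⟨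
    ℚ.∣ a ℚ.* (b ℚ.- d) ℚ.+ d ℚ.* (a ℚ.- c) ∣
      ≤⟨ ℚ.∣p+q∣≤∣p∣+∣q∣ (a ℚ.* (b ℚ.- d)) (d ℚ.* (a ℚ.- c)) ⟩
    ℚ.∣ a ℚ.* (b ℚ.- d) ∣ ℚ.+ ℚ.∣ d ℚ.* (a ℚ.- c) ∣
      <⟨ ℚ.+-mono-< h₁ h₂ ⟩
    ½ ℚ.* ε ℚ.+ ½ ℚ.* ε
      ≡⟨ half+half ε ⟩
    ε ∎
    where open ℚ.≤-Reasoning

  *-cauchy : ∀ {u v} → IsCauchy u → IsCauchy v → IsCauchy (λ n → u n ℚ.* v n)
  *-cauchy {u} {v} cu cv ε ε>0 =
    let A , A>0 , N₁ , ∣u∣≤A = eventual-bound cu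
        B , B>0 , N₂ , ∣v∣≤B = eventual-bound cv
        δ , δ>0 , small-u    = scaled A A>0 (half-pos ε>0)
        η , η>0 , small-v    = scaled B B>0 (half-pos ε>0)
        N₃ , close-v         = cv δ δ>0
        N₄ , close-u         = cu η η>0
        from₁ : ∀ {k} → (N₁ ℕ.⊔ N₂) ℕ.⊔ (N₃ ℕ.⊔ N₄) ℕ.≤ k → N₁ ℕ.≤ k
        from₁ = λ h → ℕ.m⊔n≤o⇒m≤o N₁ N₂ (ℕ.m⊔n≤o⇒m≤o (N₁ ℕ.⊔ N₂) (N₃ ℕ.⊔ N₄) h)
        from₂ : ∀ {k} → (N₁ ℕ.⊔ N₂) ℕ.⊔ (N₃ ℕ.⊔ N₄) ℕ.≤ k → N₂ ℕ.≤ k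
        from₂ = λ h → ℕ.m⊔n≤o⇒n≤o N₁ N₂ (ℕ.m⊔n≤o⇒m≤o (N₁ ℕ.⊔ N₂) (N₃ ℕ.⊔ N₄) h)
        from₃ : ∀ {k} → (N₁ ℕ.⊔ N₂) ℕ.⊔ (N₃ ℕ.⊔ N₄) ℕ.≤ k → N₃ ℕ.≤ k
        from₃ = λ h → ℕ.m⊔n≤o⇒m≤o N₃ N₄ (ℕ.m⊔n≤o⇒n≤o (N₁ ℕ.⊔ N₂) (N₃ ℕ.⊔ N₄) h)
        from₄ : ∀ {k} → (N₁ ℕ.⊔ N₂) ℕ.⊔ (N₃ ℕ.⊔ N₄) ℕ.≤ k → N₄ ℕ.≤ k
        from₄ = λ h → ℕ.m⊔n≤o⇒n≤o N₃ N₄ (ℕ.m⊔n≤o⇒n≤o (N₁ ℕ.⊔ N₂) (N₃ ℕ.⊔ N₄) h)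
    in (N₁ ℕ.⊔ N₂) ℕ.⊔ (N₃ ℕ.⊔ N₄) , λ m n N≤m N≤n →
      split-product (u m) (v m) (u n) (v n) ε
        (small-u (u m) (v m ℚ.- v n) (∣u∣≤A m (from₁ N≤m))
          (close-v m n (from₃ N≤m) (from₃ N≤n)))
        (small-v (v n) (u m ℚ.- u n) (∣v∣≤B n (from₂ N≤n))
          (close-u m n (from₄ N≤m) (from₄ N≤n)))

record ℝ : Set where
  constructor mkℝ
  field
    seq    : ℕ → ℚ
    cauchy : IsCauchy seq

open ℝ public

fromℚ : ℚ → ℝ
fromℚ q = mkℝ (λ _ → q) (const-cauchy q)

fromℕ : ℕ → ℝ
fromℕ n = fromℚ (+ n ℚ./ 1)

0ℝ 1ℝ : ℝ
0ℝ = fromℚ 0ℚ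
1ℝ = fromℚ 1ℚ

infix  8 -_
infixl 7 _*_
infixl 6 _+_ _-_
infix  4 _≃_ _<_

_+_ : ℝ → ℝ → ℝ
a + b = mkℝ (λ n → seq a n ℚ.+ seq b n) (+-cauchy {seq a} {seq b} (cauchy a) (cauchy b))

_*_ : ℝ → ℝ → ℝ
a * b = mkℝ (λ n → seq a n ℚ.* seq b n) (*-cauchy {seq a} {seq b} (cauchy a) (cauchy b))

-_ : ℝ → ℝ
- a = mkℝ (λ n → ℚ.- seq a n) (neg-cauchy {seq a} (cauchy a))

_-_ : ℝ → ℝ → ℝ
a - b = a + - b

∣_∣ : ℝ → ℝ
∣ a ∣ = mkℝ (λ n → ℚ.∣ seq a n ∣) (abs-cauchy {seq a} (cauchy a))

_≃_ : ℝ → ℝ → Set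
a ≃ b = ∀ ε → 0ℚ ℚ.< ε →
  ∃[ N ] (∀ n → N ℕ.≤ n → ℚ.∣ seq a n ℚ.- seq b n ∣ ℚ.< ε)

-- The terms must eventually be separated by a fixed positive rational:
-- termwise inequality alone would not respect _≃_.
_<_ : ℝ → ℝ → Set
a < b = ∃[ δ ] 0ℚ ℚ.< δ × ∃[ N ] (∀ n → N ℕ.≤ n → δ ℚ.< seq b n ℚ.- seq a n)

_TendsTo_ : (ℕ → ℝ) → ℝ → Set
u TendsTo L = ∀ ε → 0ℝ < ε → ∃[ N ] (∀ n → N ℕ.≤ n → ∣ u n - L ∣ < ε)

-- Partial quotients are positive rationals, so that every convergent is defined
-- and is itself a positive rational.
ℚ⁺ : Set
ℚ⁺ = Σ ℚ Positive

_+⁺_ : ℚ⁺ → ℚ⁺ → ℚ⁺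
(p , p>0) +⁺ (q , q>0) = p ℚ.+ q , ℚ.pos+pos⇒pos p {{p>0}} q {{q>0}}

1/⁺_ : ℚ⁺ → ℚ⁺
1/⁺ (p , p>0) = (ℚ.1/ p) {{ℚ.pos⇒nonZero p {{p>0}}}} , ℚ.1/pos⇒pos p {{p>0}}

-- convergent b n = [b₀, b₁, …, bₙ]
convergent : (ℕ → ℚ⁺) → ℕ → ℚ⁺
convergent b zero    = b 0
convergent b (suc n) = b 0 +⁺ (1/⁺ convergent (b ∘ suc) n)

ContinuedFraction_ConvergesTo_ : (ℕ → ℚ⁺) → ℝ → Set
ContinuedFraction b ConvergesTo L = (fromℚ ∘ proj₁ ∘ convergent b) TendsTo L

-- f 0, g 0, f 1, g 1, …
interleave : {A : Set} → (ℕ → A) → (ℕ → A) → ℕ → A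
interleave f g zero          = f 0
interleave f g (suc zero)    = g 0
interleave f g (suc (suc n)) = interleave (f ∘ suc) (g ∘ suc) n

module _ (x s : ℕ) .{{x≢0 : ℕ.NonZero x}} .{{s≢0 : ℕ.NonZero s}} where

  power quotient : ℕ → ℚ⁺
  power i = + (x ℕ.^ i) ℚ./ 1 , ℚ.normalize-pos (x ℕ.^ i) 1 {{_}} {{ℕ.m^n≢0 x i}}
  quotient i = (+ s ℚ./ (x ℕ.^ i)) {{ℕ.m^n≢0 x i}}
             , ℚ.normalize-pos s (x ℕ.^ i) {{ℕ.m^n≢0 x i}} {{s≢0}}

  -- x, s/x, x², s/x², x³, s/x³, …
  F : ℕ → ℚ⁺
  F = interleave (power ∘ suc) (quotient ∘ suc)

P : ℝ → ℝ → ℝ → ℝ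
P x z s = s * (z * z) - ((s + 1ℝ) * x - 1ℝ) * z - x

IsPositiveRoot : (ℝ → ℝ) → ℝ → Set
IsPositiveRoot p z = 0ℝ < z × p z ≃ 0ℝ

{-# OPTIONS --safe #-}
module Submission where

open import Defs
open import Data.Nat using (ℕ; NonZero)
open import Data.Product using (∃-syntax; _×_; _,_; proj₁)
open import Data.Nat as ℕ using (zero; suc)
import Data.Nat.Properties as ℕ
open import Data.Integer as ℤ using (+_; -[1+_])
import Data.Integer.Properties as ℤ
open import Data.Rational as ℚ using (ℚ; mkℚ; 0ℚ; 1ℚ; ½; Positive; NonNegative)
import Data.Rational.Properties as ℚ
open import Data.Rational.Solver using (module +-*-Solver)
open import Data.Rational.Unnormalised as ℚᵘ using (mkℚᵘ; *≡*; *≤*)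
import Data.Rational.Unnormalised.Properties as ℚᵘ
open import Data.Sum using (inj₁; inj₂)
open import Function using (_∘_; case_of_)
open import Relation.Binary.PropositionalEquality as ≡
  using (_≡_; refl; sym; trans; cong; cong₂; subst)

-- The tail of F(x,s) after two partial quotients is F(x,s) with its even
-- entries multiplied and its odd entries divided by x, so its convergents are
-- those of F(x,s) multiplied by x.  Hence cₙ₊₂ = x + 1/(s/x + 1/(x cₙ)), and
-- for P(z) = s z² − ((s+1)x − 1) z − x this gives
--   P(cₙ₊₂) (s cₙ + 1)² = x P(cₙ),
-- so P(cₙ) → 0 geometrically.  Moreover
--   P(z) w − P(w) z = (z − w)(s z w + x),
-- so points bounded away from 0 at which P is small are close to each other:
-- this shows at once that (cₙ) is Cauchy and that the positive root is unique.

-- Rational arithmetic, the embedding of the naturals and the Archimedean property.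

2ℚ : ℚ
2ℚ = 1ℚ ℚ.+ 1ℚ

half+half : ∀ q → ½ ℚ.* q ℚ.+ ½ ℚ.* q ≡ q
half+half q = trans (sym (ℚ.*-distribʳ-+ q ½ ½)) (ℚ.*-identityˡ q)

-- Moves computations with explicit numerators and denominators to unnormalised fractions, where no
-- gcd intervenes.
fromℚᵘ-homo-+ : ∀ p q → ℚ.fromℚᵘ p ℚ.+ ℚ.fromℚᵘ q ≡ ℚ.fromℚᵘ (p ℚᵘ.+ q)
fromℚᵘ-homo-+ p q = trans (sym (ℚ.fromℚᵘ-toℚᵘ _)) (ℚ.fromℚᵘ-cong
  (ℚᵘ.≃-trans (ℚ.toℚᵘ-homo-+ (ℚ.fromℚᵘ p) (ℚ.fromℚᵘ q))
    (ℚᵘ.+-cong (ℚ.toℚᵘ-fromℚᵘ p) (ℚ.toℚᵘ-fromℚᵘ q))))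

fromℚᵘ-homo-* : ∀ p q → ℚ.fromℚᵘ p ℚ.* ℚ.fromℚᵘ q ≡ ℚ.fromℚᵘ (p ℚᵘ.* q)
fromℚᵘ-homo-* p q = trans (sym (ℚ.fromℚᵘ-toℚᵘ _)) (ℚ.fromℚᵘ-cong
  (ℚᵘ.≃-trans (ℚ.toℚᵘ-homo-* (ℚ.fromℚᵘ p) (ℚ.fromℚᵘ q))
    (ℚᵘ.*-cong (ℚ.toℚᵘ-fromℚᵘ p) (ℚ.toℚᵘ-fromℚᵘ q))))

ι : ℕ → ℚ
ι n = + n ℚ./ 1

ι-homo-+ : ∀ m n → ι (m ℕ.+ n) ≡ ι m ℚ.+ ι n
ι-homo-+ m n = sym (trans (fromℚᵘ-homo-+ (mkℚᵘ (+ m) 0) (mkℚᵘ (+ n) 0))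
  (cong (ℚ._/ 1) (cong₂ ℤ._+_ (ℤ.*-identityʳ (+ m)) (ℤ.*-identityʳ (+ n)))))

ι-homo-* : ∀ m n → ι (m ℕ.* n) ≡ ι m ℚ.* ι n
ι-homo-* m n = sym (trans (fromℚᵘ-homo-* (mkℚᵘ (+ m) 0) (mkℚᵘ (+ n) 0))
  (cong (ℚ._/ 1) (sym (ℤ.pos-* m n))))

ι-nonNeg : ∀ n → NonNegative (ι n)
ι-nonNeg n = ℚ.normalize-nonNeg n 1

ι-mono-≤ : ∀ {m n} → m ℕ.≤ n → ι m ℚ.≤ ι n
ι-mono-≤ {m} {n} m≤n = begin
  ι m                   ≡⟨ ℚ.+-identityʳ (ι m) ⟨
  ι m ℚ.+ 0ℚ            ≤⟨ ℚ.+-monoʳ-≤ (ι m) (ℚ.nonNegative⁻¹ _ {{ι-nonNeg (n ℕ.∸ m)}}) ⟩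
  ι m ℚ.+ ι (n ℕ.∸ m)   ≡⟨ ι-homo-+ m (n ℕ.∸ m) ⟨
  ι (m ℕ.+ (n ℕ.∸ m))   ≡⟨ cong ι (ℕ.m+[n∸m]≡n m≤n) ⟩
  ι n ∎
  where open ℚ.≤-Reasoning

1≤ι : ∀ n .{{_ : NonZero n}} → 1ℚ ℚ.≤ ι n
1≤ι n = ι-mono-≤ {1} (ℕ.>-nonZero⁻¹ n)

ι*/-cancelˡ : ∀ m i n .{{_ : NonZero n}} .{{_ : NonZero (m ℕ.* n)}} →
  ι m ℚ.* (i ℚ./ (m ℕ.* n)) ≡ i ℚ./ n
ι*/-cancelˡ (suc m) i (suc n) =
  -- `mkℚᵘ` stores the denominator minus one, and `n + m * suc n` is the predecessor of
  -- `suc m * suc n`.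
  trans (fromℚᵘ-homo-* (mkℚᵘ (+ suc m) 0) (mkℚᵘ i (n ℕ.+ m ℕ.* suc n)))
    (ℚ.fromℚᵘ-cong
      {mkℚᵘ (+ suc m) 0 ℚᵘ.* mkℚᵘ i (n ℕ.+ m ℕ.* suc n)} {mkℚᵘ i n} (*≡* (trans (*-swap (+ suc m) i (+ suc n))
      (cong (i ℤ.*_) (trans (sym (ℤ.pos-* (suc m) (suc n)))
        (cong +_ (sym (ℕ.+-identityʳ _))))))))
  where
  *-swap : ∀ a b c → (a ℤ.* b) ℤ.* c ≡ b ℤ.* (a ℤ.* c)
  *-swap a b c = trans (cong (ℤ._* c) (ℤ.*-comm a b)) (ℤ.*-assoc b a c)

archimedean : ∀ q → ∃[ N ] q ℚ.≤ ι N
-- The denominator is at least 1, so the absolute value of the numerator is a bound.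
archimedean (mkℚ i d c) = ℤ.∣ i ∣ , ℚ.toℚᵘ-cancel-≤ (begin
  mkℚᵘ i d                      ≤⟨ *≤* (i≤ i) ⟩
  mkℚᵘ (+ ℤ.∣ i ∣) 0             ≃⟨ ℚ.toℚᵘ-fromℚᵘ (mkℚᵘ (+ ℤ.∣ i ∣) 0) ⟨
  ℚ.toℚᵘ (ι ℤ.∣ i ∣) ∎)
  where
  open ℚᵘ.≤-Reasoning
  i≤ : ∀ i → i ℤ.* + 1 ℤ.≤ + ℤ.∣ i ∣ ℤ.* + suc d
  i≤ (+ m)    = ℤ.*-monoˡ-≤-nonNeg (+ m) (ℤ.+≤+ (ℕ.s≤s ℕ.z≤n))
  i≤ -[1+ m ] = ℤ.-≤+

scaled-archimedean : ∀ C ε → 0ℚ ℚ.< ε → ∃[ N ] C ℚ.≤ ε ℚ.* ι N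
scaled-archimedean C ε ε>0 = let N , h = archimedean (ε⁻¹ ℚ.* C) in N , (begin
  C                      ≡⟨ ℚ.*-identityˡ C ⟨
  1ℚ ℚ.* C               ≡⟨ cong (ℚ._* C) (ℚ.*-inverseʳ ε) ⟨
  ε ℚ.* ε⁻¹ ℚ.* C        ≡⟨ ℚ.*-assoc ε ε⁻¹ C ⟩
  ε ℚ.* (ε⁻¹ ℚ.* C)      ≤⟨ ℚ.*-monoˡ-≤-nonNeg ε {{ℚ.pos⇒nonNeg ε}} h ⟩
  ε ℚ.* ι N ∎)
  where
  open ℚ.≤-Reasoning
  instance
    ε-pos : Positive ε
    ε-pos = ℚ.positive ε>0
    ε-nonZero : ℚ.NonZero ε
    ε-nonZero = ℚ.pos⇒nonZero ε
  ε⁻¹ : ℚ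
  ε⁻¹ = ℚ.1/ ε

-- Nonnegative sequences that at least halve every two steps.

module _ (e : ℕ → ℚ) (0≤e : ∀ n → 0ℚ ℚ.≤ e n)
         (halving : ∀ n → 2ℚ ℚ.* e (2 ℕ.+ n) ℚ.≤ e n) where

  private
    -- `halving` links indices two apart, so the even and the odd terms each need their own starting
    -- value.
    C : ℚ
    C = e 0 ℚ.* ι 2 ℚ.⊔ e 1 ℚ.* ι 3

  -- The weights n + 2 at most double when n grows by 2.
  halving⇒bounded : ∀ n → e n ℚ.* ι (2 ℕ.+ n) ℚ.≤ C
  halving⇒bounded zero          = ℚ.p≤p⊔q _ _
  halving⇒bounded (suc zero)    = ℚ.p≤q⊔p (e 0 ℚ.* ι 2) _
  halving⇒bounded (suc (suc n)) = begin
    e (2 ℕ.+ n) ℚ.* ι (4 ℕ.+ n)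
      ≤⟨ ℚ.*-monoˡ-≤-nonNeg (e (2 ℕ.+ n)) {{ℚ.nonNegative (0≤e (2 ℕ.+ n))}}
           (ι-mono-≤ (ℕ.+-monoˡ-≤ (2 ℕ.+ n) (ℕ.m≤m+n 2 n))) ⟩
    e (2 ℕ.+ n) ℚ.* ι ((2 ℕ.+ n) ℕ.+ (2 ℕ.+ n))
      ≡⟨ cong (e (2 ℕ.+ n) ℚ.*_) (ι-homo-+ (2 ℕ.+ n) (2 ℕ.+ n)) ⟩
    e (2 ℕ.+ n) ℚ.* (ι (2 ℕ.+ n) ℚ.+ ι (2 ℕ.+ n))
      ≡⟨ solve 2 (λ a b → a :* (b :+ b) := con 2ℚ :* a :* b) refl (e (2 ℕ.+ n)) (ι (2 ℕ.+ n)) ⟩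
    2ℚ ℚ.* e (2 ℕ.+ n) ℚ.* ι (2 ℕ.+ n)
      ≤⟨ ℚ.*-monoʳ-≤-nonNeg (ι (2 ℕ.+ n)) {{ι-nonNeg (2 ℕ.+ n)}} (halving n) ⟩
    e n ℚ.* ι (2 ℕ.+ n)
      ≤⟨ halving⇒bounded n ⟩
    C ∎
    where
    open ℚ.≤-Reasoning
    open +-*-Solver

  -- Decay of order 1/n suffices for a limit of zero, so a linear weight can replace powers of 2.
  halving⇒vanishing : ∀ ε → 0ℚ ℚ.< ε → ∃[ N ] (∀ n → N ℕ.≤ n → e n ℚ.< ε)
  halving⇒vanishing ε ε>0 = let N , C≤εN = scaled-archimedean C ε ε>0 in
    N , λ n N≤n → ℚ.*-cancelʳ-<-nonNeg (ι (2 ℕ.+ n)) {{ι-nonNeg (2 ℕ.+ n)}} (begin-strict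
      e n ℚ.* ι (2 ℕ.+ n)   ≤⟨ halving⇒bounded n ⟩
      C                     ≤⟨ C≤εN ⟩
      ε ℚ.* ι N             ≤⟨ ℚ.*-monoˡ-≤-nonNeg ε {{ℚ.nonNegative (ℚ.<⇒≤ ε>0)}} (ι-mono-≤ N≤n) ⟩
      -- The strict inequality comes from the offset 2 in the weight, so `N` may even be 0.
      ε ℚ.* ι n             <⟨ ℚ.*-monoʳ-<-pos ε {{ℚ.positive ε>0}} (ι<ι n) ⟩
      ε ℚ.* ι (2 ℕ.+ n) ∎)
    where
    open ℚ.≤-Reasoning
    ι<ι : ∀ n → ι n ℚ.< ι (2 ℕ.+ n)
    ι<ι n = begin-strict
      ι n             ≡⟨ ℚ.+-identityˡ (ι n) ⟨
      0ℚ ℚ.+ ι n      <⟨ ℚ.+-monoˡ-< (ι n) (ℚ.positive⁻¹ (ι 2)) ⟩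
      ι 2 ℚ.+ ι n     ≡⟨ ι-homo-+ 2 n ⟨
      ι (2 ℕ.+ n) ∎

-- Scaling of continued fractions.

1/⁺-inverseˡ : ∀ a → proj₁ (1/⁺ a) ℚ.* proj₁ a ≡ 1ℚ
1/⁺-inverseˡ (a , a>0) = ℚ.*-inverseˡ a {{ℚ.pos⇒nonZero a {{a>0}}}}

1/⁺-scale : ∀ t a b → t ℚ.* proj₁ a ≡ proj₁ b → proj₁ (1/⁺ a) ≡ t ℚ.* proj₁ (1/⁺ b)
1/⁺-scale t a b ta≡b = begin
  a⁻¹                                    ≡⟨ ℚ.*-identityʳ a⁻¹ ⟨
  a⁻¹ ℚ.* 1ℚ                             ≡⟨ cong (a⁻¹ ℚ.*_) (1/⁺-inverseˡ b) ⟨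
  a⁻¹ ℚ.* (b⁻¹ ℚ.* proj₁ b)              ≡⟨ cong (λ u → a⁻¹ ℚ.* (b⁻¹ ℚ.* u)) ta≡b ⟨
  a⁻¹ ℚ.* (b⁻¹ ℚ.* (t ℚ.* proj₁ a))      ≡⟨ regroup a⁻¹ b⁻¹ t (proj₁ a) ⟩
  a⁻¹ ℚ.* proj₁ a ℚ.* (t ℚ.* b⁻¹)        ≡⟨ cong (ℚ._* (t ℚ.* b⁻¹)) (1/⁺-inverseˡ a) ⟩
  1ℚ ℚ.* (t ℚ.* b⁻¹)                     ≡⟨ ℚ.*-identityˡ (t ℚ.* b⁻¹) ⟩
  t ℚ.* b⁻¹ ∎
  where
  open ≡.≡-Reasoning
  open +-*-Solver
  a⁻¹ b⁻¹ : ℚ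
  a⁻¹ = proj₁ (1/⁺ a)
  b⁻¹ = proj₁ (1/⁺ b)
  regroup : ∀ p q r s → p ℚ.* (q ℚ.* (r ℚ.* s)) ≡ p ℚ.* s ℚ.* (r ℚ.* q)
  regroup = solve 4 (λ p q r s → p :* (q :* (r :* s)) := p :* s :* (r :* q)) refl

+⁺-scale : ∀ t {a a′ b b′ : ℚ} → a′ ≡ t ℚ.* a → b′ ≡ t ℚ.* b → a′ ℚ.+ b′ ≡ t ℚ.* (a ℚ.+ b)
+⁺-scale t {a} {b = b} a′≡ta b′≡tb =
  trans (cong₂ ℚ._+_ a′≡ta b′≡tb) (sym (ℚ.*-distribˡ-+ t a b))

-- Each reciprocal turns a factor into its inverse, so the factor `t` returns after two levels;
-- hence the induction in steps of two. Division by `t` is phrased as a multiplication in the other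
-- direction.
convergent-scale : ∀ t f g f′ g′ →
  (∀ i → proj₁ (f′ i) ≡ t ℚ.* proj₁ (f i)) →
  (∀ i → proj₁ (g i) ≡ t ℚ.* proj₁ (g′ i)) →
  ∀ n → proj₁ (convergent (interleave f′ g′) n) ≡ t ℚ.* proj₁ (convergent (interleave f g) n)
convergent-scale t f g f′ g′ f′≡tf g≡tg′ zero       = f′≡tf 0
convergent-scale t f g f′ g′ f′≡tf g≡tg′ (suc zero) =
  +⁺-scale t (f′≡tf 0) (1/⁺-scale t (g′ 0) (g 0) (sym (g≡tg′ 0)))
convergent-scale t f g f′ g′ f′≡tf g≡tg′ (suc (suc n)) =
  +⁺-scale t (f′≡tf 0) (1/⁺-scale t (g′ 0 +⁺ (1/⁺ c′)) (g 0 +⁺ (1/⁺ c))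
    (sym (+⁺-scale t (g≡tg′ 0) (1/⁺-scale t c c′ (sym c′≡tc)))))
  where
  c c′ : ℚ⁺
  c  = convergent (interleave (f ∘ suc) (g ∘ suc)) n
  c′ = convergent (interleave (f′ ∘ suc) (g′ ∘ suc)) n
  c′≡tc : proj₁ c′ ≡ t ℚ.* proj₁ c
  c′≡tc = convergent-scale t (f ∘ suc) (g ∘ suc) (f′ ∘ suc) (g′ ∘ suc)
    (f′≡tf ∘ suc) (g≡tg′ ∘ suc) n

b₀≤convergent : ∀ b n → proj₁ (b 0) ℚ.≤ proj₁ (convergent b n)
b₀≤convergent b zero    = ℚ.≤-refl
b₀≤convergent b (suc n) = let c⁻¹ , c⁻¹>0 = 1/⁺ convergent (b ∘ suc) n in
  subst (ℚ._≤ proj₁ (b 0) ℚ.+ c⁻¹) (ℚ.+-identityʳ (proj₁ (b 0)))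
    (ℚ.+-monoʳ-≤ (proj₁ (b 0)) (ℚ.<⇒≤ (ℚ.positive⁻¹ c⁻¹ {{c⁻¹>0}})))

-- The quadratic over the rationals.

module _ (X S : ℚ) where

  Pℚ : ℚ → ℚ
  Pℚ z = S ℚ.* (z ℚ.* z) ℚ.- ((S ℚ.+ 1ℚ) ℚ.* X ℚ.- 1ℚ) ℚ.* z ℚ.- X

  Pℚ-cross : ∀ z w → Pℚ z ℚ.* w ℚ.- Pℚ w ℚ.* z ≡ (z ℚ.- w) ℚ.* (S ℚ.* (z ℚ.* w) ℚ.+ X)
  Pℚ-cross z w = solve 4 (λ X S z w →
    let p = λ z → S :* (z :* z) :- ((S :+ con 1ℚ) :* X :- con 1ℚ) :* z :- X in
    p z :* w :- p w :* z := (z :- w) :* (S :* (z :* w) :+ X)) refl X S z w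
    where open +-*-Solver

  -- The hypothesis makes `c′` the image of `c` under the Möbius map with matrix rows (XS + X, X)
  -- and (S, 1). Its fixed points are the roots of `Pℚ`, so the map preserves the associated binary
  -- form up to the determinant, which is X.
  Pℚ-step : ∀ c c′ → (S ℚ.* c ℚ.+ 1ℚ) ℚ.* c′ ≡ X ℚ.* (S ℚ.* c ℚ.+ 1ℚ) ℚ.+ X ℚ.* c →
    Pℚ c′ ℚ.* ((S ℚ.* c ℚ.+ 1ℚ) ℚ.* (S ℚ.* c ℚ.+ 1ℚ)) ≡ X ℚ.* Pℚ c
  Pℚ-step c c′ rec = begin
    Pℚ c′ ℚ.* (v ℚ.* v)                     ≡⟨ homogenise X S c′ v ⟩
    Q (v ℚ.* c′)                            ≡⟨ cong Q rec ⟩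
    Q (X ℚ.* v ℚ.+ X ℚ.* c)                 ≡⟨ invariance X S c ⟩
    X ℚ.* Pℚ c ∎
    where
    open ≡.≡-Reasoning
    open +-*-Solver
    v : ℚ
    v = S ℚ.* c ℚ.+ 1ℚ
    -- The quadratic homogenised with second variable `v`: the recurrence can be substituted for
    -- `v * c′` without dividing.
    Q : ℚ → ℚ
    Q y = S ℚ.* (y ℚ.* y) ℚ.- ((S ℚ.+ 1ℚ) ℚ.* X ℚ.- 1ℚ) ℚ.* y ℚ.* v ℚ.- X ℚ.* (v ℚ.* v)
    homogenise : ∀ X S c′ v →
      (S ℚ.* (c′ ℚ.* c′) ℚ.- ((S ℚ.+ 1ℚ) ℚ.* X ℚ.- 1ℚ) ℚ.* c′ ℚ.- X) ℚ.* (v ℚ.* v) ≡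
      S ℚ.* ((v ℚ.* c′) ℚ.* (v ℚ.* c′)) ℚ.- ((S ℚ.+ 1ℚ) ℚ.* X ℚ.- 1ℚ) ℚ.* (v ℚ.* c′) ℚ.* v
        ℚ.- X ℚ.* (v ℚ.* v)
    homogenise = solve 4 (λ X S c′ v →
      (S :* (c′ :* c′) :- ((S :+ con 1ℚ) :* X :- con 1ℚ) :* c′ :- X) :* (v :* v) :=
      S :* ((v :* c′) :* (v :* c′)) :- ((S :+ con 1ℚ) :* X :- con 1ℚ) :* (v :* c′) :* v
        :- X :* (v :* v)) refl
    invariance : ∀ X S c → let v = S ℚ.* c ℚ.+ 1ℚ ; y = X ℚ.* v ℚ.+ X ℚ.* c in
      S ℚ.* (y ℚ.* y) ℚ.- ((S ℚ.+ 1ℚ) ℚ.* X ℚ.- 1ℚ) ℚ.* y ℚ.* v ℚ.- X ℚ.* (v ℚ.* v) ≡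
      X ℚ.* (S ℚ.* (c ℚ.* c) ℚ.- ((S ℚ.+ 1ℚ) ℚ.* X ℚ.- 1ℚ) ℚ.* c ℚ.- X)
    invariance = solve 3 (λ X S c → let v = S :* c :+ con 1ℚ ; y = X :* v :+ X :* c in
      S :* (y :* y) :- ((S :+ con 1ℚ) :* X :- con 1ℚ) :* y :* v :- X :* (v :* v) :=
      X :* (S :* (c :* c) :- ((S :+ con 1ℚ) :* X :- con 1ℚ) :* c :- X)) refl

  module _ (1≤X : 1ℚ ℚ.≤ X) (1≤S : 1ℚ ℚ.≤ S) where

    private
      0≤1 : 0ℚ ℚ.≤ 1ℚ
      0≤1 = ℚ.nonNegative⁻¹ 1ℚ
      instance
        X-pos : Positive X
        X-pos = ℚ.positive (ℚ.<-≤-trans (ℚ.positive⁻¹ 1ℚ) 1≤X)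
        S-nonNeg : NonNegative S
        S-nonNeg = ℚ.nonNegative (ℚ.≤-trans 0≤1 1≤S)

    -- By `Pℚ-step` the value shrinks by X / v² with v = S c + 1. Here v is at least 2 and at least
    -- X, so v² is at least 2X.
    Pℚ-halving : ∀ c c′ → X ℚ.≤ c →
      (S ℚ.* c ℚ.+ 1ℚ) ℚ.* c′ ≡ X ℚ.* (S ℚ.* c ℚ.+ 1ℚ) ℚ.+ X ℚ.* c →
      2ℚ ℚ.* ℚ.∣ Pℚ c′ ∣ ℚ.≤ ℚ.∣ Pℚ c ∣
    Pℚ-halving c c′ X≤c rec = ℚ.*-cancelˡ-≤-pos X (begin
      X ℚ.* (2ℚ ℚ.* ℚ.∣ Pℚ c′ ∣)        ≡⟨ regroup X ℚ.∣ Pℚ c′ ∣ ⟩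
      ℚ.∣ Pℚ c′ ∣ ℚ.* (2ℚ ℚ.* X)        ≤⟨ ℚ.*-monoˡ-≤-nonNeg ℚ.∣ Pℚ c′ ∣ {{ℚ.∣-∣-nonNeg (Pℚ c′)}} 2X≤v² ⟩
      ℚ.∣ Pℚ c′ ∣ ℚ.* (v ℚ.* v)         ≡⟨ cong (ℚ.∣ Pℚ c′ ∣ ℚ.*_) (ℚ.0≤p⇒∣p∣≡p (ℚ.nonNegative⁻¹ (v ℚ.* v))) ⟨
      ℚ.∣ Pℚ c′ ∣ ℚ.* ℚ.∣ v ℚ.* v ∣     ≡⟨ ℚ.∣p*q∣≡∣p∣*∣q∣ (Pℚ c′) (v ℚ.* v) ⟨
      ℚ.∣ Pℚ c′ ℚ.* (v ℚ.* v) ∣         ≡⟨ cong ℚ.∣_∣ (Pℚ-step c c′ rec) ⟩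
      ℚ.∣ X ℚ.* Pℚ c ∣                  ≡⟨ ℚ.∣p*q∣≡∣p∣*∣q∣ X (Pℚ c) ⟩
      ℚ.∣ X ∣ ℚ.* ℚ.∣ Pℚ c ∣            ≡⟨ cong (ℚ._* ℚ.∣ Pℚ c ∣) (ℚ.0≤p⇒∣p∣≡p (ℚ.<⇒≤ (ℚ.positive⁻¹ X))) ⟩
      X ℚ.* ℚ.∣ Pℚ c ∣ ∎)
      where
      open ℚ.≤-Reasoning
      open +-*-Solver
      v : ℚ
      v = S ℚ.* c ℚ.+ 1ℚ
      regroup : ∀ x e → x ℚ.* (2ℚ ℚ.* e) ≡ e ℚ.* (2ℚ ℚ.* x)
      regroup = solve 2 (λ x e → x :* (con 2ℚ :* e) := e :* (con 2ℚ :* x)) refl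
      c≤Sc : c ℚ.≤ S ℚ.* c
      c≤Sc = subst (ℚ._≤ S ℚ.* c) (ℚ.*-identityˡ c)
        (ℚ.*-monoʳ-≤-nonNeg c {{ℚ.nonNegative (ℚ.≤-trans (ℚ.≤-trans 0≤1 1≤X) X≤c)}} 1≤S)
      2≤v : 2ℚ ℚ.≤ v
      2≤v = ℚ.+-monoˡ-≤ 1ℚ (ℚ.≤-trans (ℚ.≤-trans 1≤X X≤c) c≤Sc)
      X≤v : X ℚ.≤ v
      X≤v = subst (ℚ._≤ v) (ℚ.+-identityʳ X) (ℚ.+-mono-≤ (ℚ.≤-trans X≤c c≤Sc) 0≤1)
      instance
        v-nonNeg : NonNegative v
        v-nonNeg = ℚ.nonNegative (ℚ.≤-trans (ℚ.≤-trans 0≤1 1≤X) X≤v)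
        v²-nonNeg : NonNegative (v ℚ.* v)
        v²-nonNeg = ℚ.nonNeg*nonNeg⇒nonNeg v v
      2X≤v² : 2ℚ ℚ.* X ℚ.≤ v ℚ.* v
      2X≤v² = ℚ.≤-trans (ℚ.*-monoˡ-≤-nonNeg 2ℚ X≤v) (ℚ.*-monoʳ-≤-nonNeg v 2≤v)

    -- By `Pℚ-cross`, |z - w| z w is at most |P(z)| w + |P(w)| z. Multiplying by `a` and bounding it
    -- by `z` in the first term and by `w` in the second makes z w a common factor, which cancels.
    Pℚ-separation : ∀ a z w → 0ℚ ℚ.< a → a ℚ.≤ z → a ℚ.≤ w →
      a ℚ.* ℚ.∣ z ℚ.- w ∣ ℚ.≤ ℚ.∣ Pℚ z ∣ ℚ.+ ℚ.∣ Pℚ w ∣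
    Pℚ-separation a z w a>0 a≤z a≤w = ℚ.*-cancelʳ-≤-pos (z ℚ.* w) (begin
      a ℚ.* d ℚ.* (z ℚ.* w)
        ≡⟨ ℚ.*-assoc a d (z ℚ.* w) ⟩
      a ℚ.* (d ℚ.* (z ℚ.* w))
        ≤⟨ ℚ.*-monoˡ-≤-nonNeg a (ℚ.*-monoˡ-≤-nonNeg d zw≤Szw+X) ⟩
      a ℚ.* (d ℚ.* r)
        ≡⟨ cong (λ t → a ℚ.* (d ℚ.* t)) (ℚ.0≤p⇒∣p∣≡p 0≤r) ⟨
      a ℚ.* (d ℚ.* ℚ.∣ r ∣)
        ≡⟨ cong (a ℚ.*_) (ℚ.∣p*q∣≡∣p∣*∣q∣ (z ℚ.- w) r) ⟨
      a ℚ.* ℚ.∣ (z ℚ.- w) ℚ.* r ∣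
        ≡⟨ cong (λ t → a ℚ.* ℚ.∣ t ∣) (Pℚ-cross z w) ⟨
      a ℚ.* ℚ.∣ Pℚ z ℚ.* w ℚ.- Pℚ w ℚ.* z ∣
        ≤⟨ ℚ.*-monoˡ-≤-nonNeg a (ℚ.∣p-q∣≤∣p∣+∣q∣ (Pℚ z ℚ.* w) (Pℚ w ℚ.* z)) ⟩
      a ℚ.* (ℚ.∣ Pℚ z ℚ.* w ∣ ℚ.+ ℚ.∣ Pℚ w ℚ.* z ∣)
        ≡⟨ cong (a ℚ.*_) (cong₂ ℚ._+_ (∣p*w∣ (Pℚ z) w) (∣p*w∣ (Pℚ w) z)) ⟩
      a ℚ.* (ℚ.∣ Pℚ z ∣ ℚ.* w ℚ.+ ℚ.∣ Pℚ w ∣ ℚ.* z)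
        ≡⟨ ℚ.*-distribˡ-+ a _ _ ⟩
      a ℚ.* (ℚ.∣ Pℚ z ∣ ℚ.* w) ℚ.+ a ℚ.* (ℚ.∣ Pℚ w ∣ ℚ.* z)
        ≤⟨ ℚ.+-mono-≤ (ℚ.*-monoʳ-≤-nonNeg (ℚ.∣ Pℚ z ∣ ℚ.* w) a≤z)
                      (ℚ.*-monoʳ-≤-nonNeg (ℚ.∣ Pℚ w ∣ ℚ.* z) a≤w) ⟩
      z ℚ.* (ℚ.∣ Pℚ z ∣ ℚ.* w) ℚ.+ w ℚ.* (ℚ.∣ Pℚ w ∣ ℚ.* z)
        ≡⟨ regroup z w ℚ.∣ Pℚ z ∣ ℚ.∣ Pℚ w ∣ ⟩
      (ℚ.∣ Pℚ z ∣ ℚ.+ ℚ.∣ Pℚ w ∣) ℚ.* (z ℚ.* w) ∎)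
      where
      open ℚ.≤-Reasoning
      open +-*-Solver
      d r : ℚ
      d = ℚ.∣ z ℚ.- w ∣
      r = S ℚ.* (z ℚ.* w) ℚ.+ X
      regroup : ∀ z w p q →
        z ℚ.* (p ℚ.* w) ℚ.+ w ℚ.* (q ℚ.* z) ≡ (p ℚ.+ q) ℚ.* (z ℚ.* w)
      regroup = solve 4 (λ z w p q →
        z :* (p :* w) :+ w :* (q :* z) := (p :+ q) :* (z :* w)) refl
      instance
        a-pos : Positive a
        a-pos = ℚ.positive a>0
        z-pos : Positive z
        z-pos = ℚ.positive (ℚ.<-≤-trans a>0 a≤z)
        w-pos : Positive w
        w-pos = ℚ.positive (ℚ.<-≤-trans a>0 a≤w)
        zw-pos : Positive (z ℚ.* w)
        zw-pos = ℚ.pos*pos⇒pos z w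
        a-nonNeg : NonNegative a
        a-nonNeg = ℚ.pos⇒nonNeg a
        d-nonNeg : NonNegative d
        d-nonNeg = ℚ.∣-∣-nonNeg (z ℚ.- w)
        Pz*w-nonNeg : NonNegative (ℚ.∣ Pℚ z ∣ ℚ.* w)
        Pz*w-nonNeg = ℚ.nonNeg*nonNeg⇒nonNeg ℚ.∣ Pℚ z ∣ {{ℚ.∣-∣-nonNeg (Pℚ z)}} w {{ℚ.pos⇒nonNeg w}}
        Pw*z-nonNeg : NonNegative (ℚ.∣ Pℚ w ∣ ℚ.* z)
        Pw*z-nonNeg = ℚ.nonNeg*nonNeg⇒nonNeg ℚ.∣ Pℚ w ∣ {{ℚ.∣-∣-nonNeg (Pℚ w)}} z {{ℚ.pos⇒nonNeg z}}
      ∣p*w∣ : ∀ p w .{{_ : Positive w}} → ℚ.∣ p ℚ.* w ∣ ≡ ℚ.∣ p ∣ ℚ.* w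
      ∣p*w∣ p w = trans (ℚ.∣p*q∣≡∣p∣*∣q∣ p w)
        (cong (ℚ.∣ p ∣ ℚ.*_) (ℚ.0≤p⇒∣p∣≡p (ℚ.<⇒≤ (ℚ.positive⁻¹ w))))
      zw≤Szw+X : z ℚ.* w ℚ.≤ r
      zw≤Szw+X = begin
        z ℚ.* w                     ≡⟨ ℚ.*-identityˡ (z ℚ.* w) ⟨
        1ℚ ℚ.* (z ℚ.* w)            ≡⟨ ℚ.+-identityʳ _ ⟨
        1ℚ ℚ.* (z ℚ.* w) ℚ.+ 0ℚ     ≤⟨ ℚ.+-mono-≤
          (ℚ.*-monoʳ-≤-nonNeg (z ℚ.* w) {{ℚ.pos⇒nonNeg (z ℚ.* w)}} 1≤S) (ℚ.<⇒≤ (ℚ.positive⁻¹ X)) ⟩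
        r ∎
      0≤r : 0ℚ ℚ.≤ r
      0≤r = ℚ.≤-trans (ℚ.<⇒≤ (ℚ.positive⁻¹ (z ℚ.* w))) zw≤Szw+X

    -- Phrased for small values of `Pℚ` because the terms of a sequence representing a real root are
    -- only approximate roots.
    near-roots-close : ∀ a → 0ℚ ℚ.< a → ∀ ε → 0ℚ ℚ.< ε →
      ∃[ δ ] 0ℚ ℚ.< δ × (∀ z w → a ℚ.≤ z → a ℚ.≤ w →
        ℚ.∣ Pℚ z ∣ ℚ.< δ → ℚ.∣ Pℚ w ∣ ℚ.< δ → ℚ.∣ z ℚ.- w ∣ ℚ.< ε)
    near-roots-close a a>0 ε ε>0 = δ , ℚ.positive⁻¹ δ {{δ-pos}} ,
      λ z w a≤z a≤w Pz<δ Pw<δ → ℚ.*-cancelˡ-<-nonNeg a {{ℚ.pos⇒nonNeg a}} (begin-strict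
        a ℚ.* ℚ.∣ z ℚ.- w ∣           ≤⟨ Pℚ-separation a z w a>0 a≤z a≤w ⟩
        ℚ.∣ Pℚ z ∣ ℚ.+ ℚ.∣ Pℚ w ∣     <⟨ ℚ.+-mono-< Pz<δ Pw<δ ⟩
        δ ℚ.+ δ                       ≡⟨ half+half (a ℚ.* ε) ⟩
        a ℚ.* ε ∎)
      where
      open ℚ.≤-Reasoning
      instance
        a-pos : Positive a
        a-pos = ℚ.positive a>0
        ε-pos : Positive ε
        ε-pos = ℚ.positive ε>0
      δ : ℚ
      -- The two values of `Pℚ` share the budget `a * ε` left by `Pℚ-separation`.
      δ = ½ ℚ.* (a ℚ.* ε)
      δ-pos : Positive δ
      δ-pos = ℚ.pos*pos⇒pos ½ (a ℚ.* ε) {{ℚ.pos*pos⇒pos a ε}}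

-- Convergence of a Cauchy sequence to the real that it represents.

seq-tendsTo : ∀ a → (fromℚ ∘ seq a) TendsTo a
-- The real `ε` is known only through its eventual lower bound `δ`. One half of `δ` bounds the
-- Cauchy error; the other half is the gap that `<` demands.
seq-tendsTo a ε (δ , δ>0 , M , δ<ε) = let N , h = cauchy a (½ ℚ.* δ) ½δ>0 in
  N , λ n N≤n → ½ ℚ.* δ , ½δ>0 , M ℕ.⊔ N , λ m M⊔N≤m → begin-strict
    ½ ℚ.* δ
      ≡⟨ half-diff δ ⟨
    δ ℚ.- ½ ℚ.* δ
      <⟨ ℚ.+-mono-< (subst (δ ℚ.<_) (ℚ.+-identityʳ (seq ε m)) (δ<ε m (ℕ.m⊔n≤o⇒m≤o M N M⊔N≤m)))
                    (ℚ.neg-antimono-< (h n m N≤n (ℕ.m⊔n≤o⇒n≤o M N M⊔N≤m))) ⟩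
    seq ε m ℚ.- ℚ.∣ seq a n ℚ.- seq a m ∣ ∎
  where
  open ℚ.≤-Reasoning
  open +-*-Solver
  half-diff : ∀ δ → δ ℚ.- ½ ℚ.* δ ≡ ½ ℚ.* δ
  half-diff = solve 1 (λ δ → δ :- con ½ :* δ := con ½ :* δ) refl
  ½δ>0 : 0ℚ ℚ.< ½ ℚ.* δ
  ½δ>0 = ℚ.positive⁻¹ (½ ℚ.* δ) {{ℚ.pos*pos⇒pos ½ δ {{ℚ.positive δ>0}}}}

-- The convergents of F(x,s), their limit and its uniqueness as a positive root.

module _ (x s : ℕ) .{{_ : NonZero x}} .{{_ : NonZero s}} where

  private
    X S : ℚ
    X = ι x
    S = ι s

    1≤X : 1ℚ ℚ.≤ X
    1≤X = 1≤ι x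

    1≤S : 1ℚ ℚ.≤ S
    1≤S = 1≤ι s

    p : ℚ → ℚ
    p = Pℚ X S

    c : ℕ → ℚ
    c = proj₁ ∘ convergent (F x s)

  power-suc : ∀ i → proj₁ (power x s (suc i)) ≡ X ℚ.* proj₁ (power x s i)
  power-suc i = ι-homo-* x (x ℕ.^ i)

  quotient-suc : ∀ i → proj₁ (quotient x s i) ≡ X ℚ.* proj₁ (quotient x s (suc i))
  quotient-suc i = sym (ι*/-cancelˡ x (+ s) (x ℕ.^ i) {{ℕ.m^n≢0 x i}} {{ℕ.m^n≢0 x (suc i)}})

  -- With d = X cₙ and v = s/x + 1/d, clearing denominators gives S cₙ + 1 = v d. Multiplying cₙ₊₂ =
  -- X + 1/v by this leaves only d from the fraction.
  convergent-recurrence : ∀ n →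
    (S ℚ.* c n ℚ.+ 1ℚ) ℚ.* c (2 ℕ.+ n) ≡ X ℚ.* (S ℚ.* c n ℚ.+ 1ℚ) ℚ.+ X ℚ.* c n
  convergent-recurrence n = begin
    (S ℚ.* c n ℚ.+ 1ℚ) ℚ.* (proj₁ b₀ ℚ.+ u)
      ≡⟨ cong (λ t → (S ℚ.* c n ℚ.+ 1ℚ) ℚ.* (t ℚ.+ u)) b₀≡X ⟩
    (S ℚ.* c n ℚ.+ 1ℚ) ℚ.* (X ℚ.+ u)
      ≡⟨ split X S (c n) u ⟩
    X ℚ.* (S ℚ.* c n ℚ.+ 1ℚ) ℚ.+ u ℚ.* (S ℚ.* c n ℚ.+ 1ℚ)
      ≡⟨ cong (λ t → X ℚ.* (S ℚ.* c n ℚ.+ 1ℚ) ℚ.+ u ℚ.* t) Sc+1 ⟩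
    X ℚ.* (S ℚ.* c n ℚ.+ 1ℚ) ℚ.+ u ℚ.* (proj₁ v ℚ.* proj₁ d)
      ≡⟨ cong (X ℚ.* (S ℚ.* c n ℚ.+ 1ℚ) ℚ.+_) (sym (ℚ.*-assoc u (proj₁ v) (proj₁ d))) ⟩
    X ℚ.* (S ℚ.* c n ℚ.+ 1ℚ) ℚ.+ u ℚ.* proj₁ v ℚ.* proj₁ d
      ≡⟨ cong (λ t → X ℚ.* (S ℚ.* c n ℚ.+ 1ℚ) ℚ.+ t ℚ.* proj₁ d) (1/⁺-inverseˡ v) ⟩
    X ℚ.* (S ℚ.* c n ℚ.+ 1ℚ) ℚ.+ 1ℚ ℚ.* proj₁ d
      ≡⟨ cong (X ℚ.* (S ℚ.* c n ℚ.+ 1ℚ) ℚ.+_) (trans (ℚ.*-identityˡ (proj₁ d)) d≡Xc) ⟩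
    X ℚ.* (S ℚ.* c n ℚ.+ 1ℚ) ℚ.+ X ℚ.* c n ∎
    where
    open ≡.≡-Reasoning
    b₀ b₁ d v : ℚ⁺
    b₀ = power x s 1
    b₁ = quotient x s 1
    d = convergent (F x s ∘ suc ∘ suc) n
    v = b₁ +⁺ (1/⁺ d)
    u : ℚ
    u = proj₁ (1/⁺ v)
    b₀≡X : proj₁ b₀ ≡ X
    b₀≡X = trans (power-suc 0) (ℚ.*-identityʳ X)
    d≡Xc : proj₁ d ≡ X ℚ.* c n
    d≡Xc = convergent-scale X (power x s ∘ suc) (quotient x s ∘ suc)
      (power x s ∘ suc ∘ suc) (quotient x s ∘ suc ∘ suc)
      (power-suc ∘ suc) (quotient-suc ∘ suc) n
    split : ∀ X S c u → (S ℚ.* c ℚ.+ 1ℚ) ℚ.* (X ℚ.+ u) ≡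
      X ℚ.* (S ℚ.* c ℚ.+ 1ℚ) ℚ.+ u ℚ.* (S ℚ.* c ℚ.+ 1ℚ)
    split = solve 4 (λ X S c u → (S :* c :+ con 1ℚ) :* (X :+ u) :=
      X :* (S :* c :+ con 1ℚ) :+ u :* (S :* c :+ con 1ℚ)) refl
      where open +-*-Solver
    swap : ∀ X q c → X ℚ.* q ℚ.* c ≡ q ℚ.* (X ℚ.* c)
    swap = solve 3 (λ X q c → X :* q :* c := q :* (X :* c)) refl
      where open +-*-Solver
    Sc+1 : S ℚ.* c n ℚ.+ 1ℚ ≡ proj₁ v ℚ.* proj₁ d
    Sc+1 = begin
      S ℚ.* c n ℚ.+ 1ℚ
        -- `S` is `quotient` at exponent 0, hence X times the first odd partial quotient.
        ≡⟨ cong₂ (λ p q → p ℚ.* c n ℚ.+ q) (quotient-suc 0) (sym (1/⁺-inverseˡ d)) ⟩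
      X ℚ.* proj₁ b₁ ℚ.* c n ℚ.+ proj₁ (1/⁺ d) ℚ.* proj₁ d
        ≡⟨ cong (ℚ._+ proj₁ (1/⁺ d) ℚ.* proj₁ d)
             (trans (swap X (proj₁ b₁) (c n)) (cong (proj₁ b₁ ℚ.*_) (sym d≡Xc))) ⟩
      proj₁ b₁ ℚ.* proj₁ d ℚ.+ proj₁ (1/⁺ d) ℚ.* proj₁ d
        ≡⟨ ℚ.*-distribʳ-+ (proj₁ d) (proj₁ b₁) (proj₁ (1/⁺ d)) ⟨
      proj₁ v ℚ.* proj₁ d ∎

  X≤c : ∀ n → X ℚ.≤ c n
  X≤c n = subst (ℚ._≤ c n) (trans (power-suc 0) (ℚ.*-identityʳ X)) (b₀≤convergent (F x s) n)

  1≤c : ∀ n → 1ℚ ℚ.≤ c n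
  1≤c n = ℚ.≤-trans 1≤X (X≤c n)

  Pc-vanishing : ∀ ε → 0ℚ ℚ.< ε → ∃[ N ] (∀ n → N ℕ.≤ n → ℚ.∣ p (c n) ∣ ℚ.< ε)
  Pc-vanishing = halving⇒vanishing (λ n → ℚ.∣ p (c n) ∣) (λ n → ℚ.0≤∣p∣ (p (c n)))
    (λ n → Pℚ-halving X S 1≤X 1≤S (c n) (c (2 ℕ.+ n)) (X≤c n) (convergent-recurrence n))

  c-cauchy : IsCauchy c
  c-cauchy ε ε>0 =
    let δ , δ>0 , close = near-roots-close X S 1≤X 1≤S 1ℚ (ℚ.positive⁻¹ 1ℚ) ε ε>0
        N , small = Pc-vanishing δ δ>0
    in N , λ m n N≤m N≤n → close (c m) (c n) (1≤c m) (1≤c n) (small m N≤m) (small n N≤n)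

  -- The convergents themselves represent the limit, which reduces convergence to `seq-tendsTo`.
  limit : ℝ
  limit = mkℝ c c-cauchy

  private
    IsRoot⁺ : ℝ → Set
    IsRoot⁺ = IsPositiveRoot (λ z → P (fromℕ x) z (fromℕ s))

  limit-root : IsRoot⁺ limit
  -- A convergent can equal 1 (x = 1, n = 0), so the strict lower bound has to lie below 1.
  limit-root = (½ , ℚ.positive⁻¹ ½ , 0 , λ n _ →
                 subst (½ ℚ.<_) (sym (ℚ.+-identityʳ (c n))) (ℚ.<-≤-trans ½<1 (1≤c n)))
             -- Real operations act termwise, so the terms of `P` at `limit` are the values
             -- `p (c n)`.
             , λ ε ε>0 → let N , small = Pc-vanishing ε ε>0 in
                 N , λ n N≤n → subst (λ t → ℚ.∣ t ∣ ℚ.< ε) (sym (ℚ.+-identityʳ (p (c n)))) (small n N≤n)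
    where
    ½<1 : ½ ℚ.< 1ℚ
    ½<1 = ℚ.*<* (ℤ.+<+ (ℕ.s≤s (ℕ.s≤s ℕ.z≤n)))

  root-unique : ∀ z → IsRoot⁺ z → z ≃ limit
  root-unique z ((η , η>0 , N₁ , η<z) , Pz≃0) ε ε>0 =
    -- A common lower bound: `η` for the late terms of `z`, 1 for the convergents.
    let a = η ℚ.⊓ 1ℚ
        δ , δ>0 , close = near-roots-close X S 1≤X 1≤S a (⊓-pos η>0) ε ε>0
        N₂ , small-z = Pz≃0 δ δ>0
        N₃ , small-c = Pc-vanishing δ δ>0
    in N₁ ℕ.⊔ (N₂ ℕ.⊔ N₃) , λ n N≤n →
      let N₂⊔N₃≤n = ℕ.m⊔n≤o⇒n≤o N₁ (N₂ ℕ.⊔ N₃) N≤n in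
      close (seq z n) (c n)
        (ℚ.≤-trans (ℚ.p⊓q≤p η 1ℚ) (ℚ.<⇒≤ (subst (η ℚ.<_) (ℚ.+-identityʳ (seq z n))
          (η<z n (ℕ.m⊔n≤o⇒m≤o N₁ (N₂ ℕ.⊔ N₃) N≤n)))))
        (ℚ.≤-trans (ℚ.p⊓q≤q η 1ℚ) (1≤c n))
        (subst (λ t → ℚ.∣ t ∣ ℚ.< δ) (ℚ.+-identityʳ (p (seq z n))) (small-z n (ℕ.m⊔n≤o⇒m≤o N₂ N₃ N₂⊔N₃≤n)))
        (small-c n (ℕ.m⊔n≤o⇒n≤o N₂ N₃ N₂⊔N₃≤n))
    where
    ⊓-pos : ∀ {η} → 0ℚ ℚ.< η → 0ℚ ℚ.< η ℚ.⊓ 1ℚ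
    ⊓-pos {η} η>0 = case ℚ.⊓-sel η 1ℚ of λ where
      (inj₁ ≡η) → subst (0ℚ ℚ.<_) (sym ≡η) η>0
      (inj₂ ≡1) → subst (0ℚ ℚ.<_) (sym ≡1) (ℚ.positive⁻¹ 1ℚ)

theorem16 : (x s : ℕ) .{{_ : NonZero x}} .{{_ : NonZero s}} →
    let IsRoot⁺ = IsPositiveRoot (λ z → P (fromℕ x) z (fromℕ s)) in
    ∃[ L ] IsRoot⁺ L × (∀ z → IsRoot⁺ z → z ≃ L) × ContinuedFraction F x s ConvergesTo L
theorem16 x s = limit x s , limit-root x s , root-unique x s , seq-tendsTo (limit x s)
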